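{- The set $\mathcal{LP}_4$ is decomposed into the following two disjoint subsets. (i) The subset $\mathcal{LP}_{4,1}\sqcup\mathcal{LP}_{4,2}$, which is formed by the $144$ polynomials with separate variables of the form $$s_{20}x^2+s_{02}y^2+s_{10}x+s_{01}y+s_{00}\in\mathbb{F}_4[x,y],\quad\text{where } s_{01}^3+s_{02}^3=s_{10}^3+s_{20}^3=1.$$ (ii) The subset $\mathcal{LP}_{4,4}$, which is formed by the $432$ polynomials of the form $$(s_{22}xy+s_{21}x+s_{12}y+s_{12}s_{21}s_{22}^2)xy+s_{20}x^2+s_{02}y^2+(s_{20}s_{22}+s_{21}^2)s_{12}s_{22}x+(s_{02}s_{22}+s_{12}^2)s_{21}s_{22}y+s_{00}\in\mathbb{F}_4[x,y],$$ where $$s_{22}^3=s_{21}^3=s_{12}^3=1,\qquad s_{20}(s_{20}s_{22}+s_{21}^2)=0,\qquad s_{02}(s_{02}s_{22}+s_{12}^2)=0.$$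
   Context: $\mathbb{F}_4$ is the field with four elements; all coefficients $s_{ij}$ lie in $\mathbb{F}_4$. $\mathcal{LP}_4$ is the set of local permutation polynomials over $\mathbb{F}_4$: polynomials $f\in\mathbb{F}_4[x,y]$ of degree less than $4$ in each variable such that, for every $a\in\mathbb{F}_4$, both $f(x,a)$ and $f(a,x)$ act as permutations of $\mathbb{F}_4$. $\mathcal{LP}_{4,d}$ is the subset of polynomials of total degree $d$ in $\mathcal{LP}_4$. A polynomial in $\mathcal{LP}_4$ has separate variables if it is of the form $h_1(x)+h_2(y)$ with $h_1,h_2$ polynomials of degree less than $4$ that act as permutations of $\mathbb{F}_4$. -}

module Defs where

open import Algebra.Apartness.Bundles using (HeytingField)
open import Algebra.Bundles using (CommutativeRing; Semiring)
open import Algebra.Core using (Op₁; Op₂)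
open import Algebra.Structures using (IsCommutativeRing)
import Algebra.Definitions.RawSemiring as RawSemiringDefinitions
open import Data.Fin.Base using (Fin; toℕ)
open import Data.Fin.Patterns using (0F; 1F; 2F)
open import Data.List.Base using (List; length)
open import Data.List.Membership.Propositional using () renaming (_∈_ to _∈ₗ_)
open import Data.List.Relation.Unary.Unique.Propositional using (Unique)
import Data.Nat.Base as ℕ
open ℕ using (ℕ)
open import Data.Product.Base using (_×_; _,_; ∃-syntax; Σ-syntax)
open import Data.Vec.Base using (Vec; _∷_; lookup; map; replicate; zipWith; _[_]≔_)
open import Function.Definitions using (Bijective)
open import Level using (0ℓ)
open import Relation.Binary.Definitions using (DecidableEquality)
open import Relation.Binary.PropositionalEquality
  using (_≡_; _≢_; refl; cong; cong₂; isEquivalence)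
open import Relation.Binary.PropositionalEquality.Properties using (decSetoid)
import Relation.Binary.Properties.DecSetoid as DecSetoidProperties
open import Relation.Nullary.Decidable
  using (Dec; yes; no; map′; from-yes; ¬?; _×-dec_; _→-dec_)
open import Relation.Unary using (Pred; Decidable; _≐_)

-- The field with four elements: ω² + ω + 1 = 0 and ω² is the square of ω.

data 𝔽₄ : Set where
  0# 1# ω ω² : 𝔽₄

infixl 6 _+_
infixl 7 _*_

_+_ : Op₂ 𝔽₄
0# + b  = b
a  + 0# = a
1# + 1# = 0#
1# + ω  = ω²
1# + ω² = ω
ω  + 1# = ω²
ω  + ω  = 0#
ω  + ω² = 1#
ω² + 1# = ω
ω² + ω  = 1#
ω² + ω² = 0#

_*_ : Op₂ 𝔽₄
0# * b  = 0#
a  * 0# = 0#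
1# * b  = b
a  * 1# = a
ω  * ω  = ω²
ω  * ω² = 1#
ω² * ω  = 1#
ω² * ω² = ω

-- Characteristic 2.
-_ : Op₁ 𝔽₄
- a = a

infix 4 _≟_

_≟_ : DecidableEquality 𝔽₄
0# ≟ 0# = yes refl
0# ≟ 1# = no λ ()
0# ≟ ω  = no λ ()
0# ≟ ω² = no λ ()
1# ≟ 0# = no λ ()
1# ≟ 1# = yes refl
1# ≟ ω  = no λ ()
1# ≟ ω² = no λ ()
ω  ≟ 0# = no λ ()
ω  ≟ 1# = no λ ()
ω  ≟ ω  = yes refl
ω  ≟ ω² = no λ ()
ω² ≟ 0# = no λ ()
ω² ≟ 1# = no λ ()
ω² ≟ ω  = no λ ()
ω² ≟ ω² = yes refl

all? : ∀ {p} {P : Pred 𝔽₄ p} → Decidable P → Dec (∀ a → P a)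
all? P? = map′
  (λ { (p , q , r , s) → λ { 0# → p ; 1# → q ; ω → r ; ω² → s } })
  (λ f → f 0# , f 1# , f ω , f ω²)
  (P? 0# ×-dec P? 1# ×-dec P? ω ×-dec P? ω²)

isCommutativeRing : IsCommutativeRing _≡_ _+_ _*_ -_ 0# 1#
isCommutativeRing = record
  { isRing = record
    { +-isAbelianGroup = record
      { isGroup = record
        { isMonoid = record
          { isSemigroup = record
            { isMagma = record { isEquivalence = isEquivalence ; ∙-cong = cong₂ _+_ }
            ; assoc = from-yes (all? λ a → all? λ b → all? λ c →
                (a + b) + c ≟ a + (b + c))
            }
          ; identity = from-yes (all? λ a → 0# + a ≟ a)
                     , from-yes (all? λ a → a + 0# ≟ a)
          }
        ; inverse = from-yes (all? λ a → - a + a ≟ 0#)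
                  , from-yes (all? λ a → a + - a ≟ 0#)
        ; ⁻¹-cong = cong -_
        }
      ; comm = from-yes (all? λ a → all? λ b → a + b ≟ b + a)
      }
    ; *-cong = cong₂ _*_
    ; *-assoc = from-yes (all? λ a → all? λ b → all? λ c →
        (a * b) * c ≟ a * (b * c))
    ; *-identity = from-yes (all? λ a → 1# * a ≟ a)
                 , from-yes (all? λ a → a * 1# ≟ a)
    ; distrib = from-yes (all? λ a → all? λ b → all? λ c →
                  a * (b + c) ≟ a * b + a * c)
              , from-yes (all? λ a → all? λ b → all? λ c →
                  (b + c) * a ≟ b * a + c * a)
    }
  ; *-comm = from-yes (all? λ a → all? λ b → a * b ≟ b * a)
  }

commutativeRing : CommutativeRing 0ℓ 0ℓ
commutativeRing = record { isCommutativeRing = isCommutativeRing }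

open CommutativeRing commutativeRing public using (_-_; semiring)
open RawSemiringDefinitions (Semiring.rawSemiring semiring) public using (_^_; sum)

-- Every nonzero a satisfies a³ = 1, so a² is its inverse.
heytingField : HeytingField 0ℓ 0ℓ 0ℓ
heytingField = record
  { isHeytingField = record
    { isHeytingCommutativeRing = record
      { isCommutativeRing   = isCommutativeRing
      ; isApartnessRelation = ≉-isApartnessRelation
      ; #⇒invertible        = λ {a} {b} a≢b →
            (a - b) ^ 2
          , from-yes (all? λ a → all? λ b →
              ¬? (a ≟ b) →-dec (a - b) ^ 2 * (a - b) ≟ 1#) a b a≢b
          , from-yes (all? λ a → all? λ b →
              ¬? (a ≟ b) →-dec (a - b) * (a - b) ^ 2 ≟ 1#) a b a≢b
      ; invertible⇒#        = λ {a} {b} (c , ca≡1 , _) →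
          from-yes (all? λ a → all? λ b → all? λ c →
            c * (a - b) ≟ 1# →-dec ¬? (a ≟ b)) a b c ca≡1
      }
    ; tight = ≉-tight
    }
  }
  where open DecSetoidProperties (decSetoid _≟_)

-- Polynomials of degree < 4 in the variable: entry i is the coefficient of tⁱ.

Poly₁ : Set
Poly₁ = Vec 𝔽₄ 4

eval₁ : Poly₁ → 𝔽₄ → 𝔽₄
eval₁ h a = sum λ i → lookup h i * a ^ toℕ i

-- Polynomials in 𝔽₄[x,y] of degree < 4 in each variable: entry j of row i is
-- the coefficient of xⁱyʲ.

Poly : Set
Poly = Vec (Vec 𝔽₄ 4) 4

coeff : Poly → Fin 4 → Fin 4 → 𝔽₄
coeff f i j = lookup (lookup f i) j

eval : Poly → 𝔽₄ → 𝔽₄ → 𝔽₄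
eval f a b = sum λ i → sum λ j → coeff f i j * a ^ toℕ i * b ^ toℕ j

0ₚ : Poly
0ₚ = replicate 4 (replicate 4 0#)

infixl 4 _⊕_
_⊕_ : Poly → Poly → Poly
_⊕_ = zipWith (zipWith _+_)

-- The monomial c xⁱ yʲ; it binds weaker than the arithmetic of 𝔽₄, so that
-- c may be a compound expression.
infix 5 _x^_y^_
_x^_y^_ : 𝔽₄ → Fin 4 → Fin 4 → Poly
c x^ i y^ j = 0ₚ [ i ]≔ (replicate 4 0# [ j ]≔ c)

_inX : Poly₁ → Poly
h inX = map (λ c → c ∷ replicate 3 0#) h

_inY : Poly₁ → Poly
h inY = h ∷ replicate 3 (replicate 4 0#)

HasTotalDegree : Poly → ℕ → Set
HasTotalDegree f d =
    (∃[ i ] ∃[ j ] toℕ i ℕ.+ toℕ j ≡ d × coeff f i j ≢ 0#)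
  × (∀ i j → d ℕ.< toℕ i ℕ.+ toℕ j → coeff f i j ≡ 0#)

IsPermutation : (𝔽₄ → 𝔽₄) → Set
IsPermutation = Bijective _≡_ _≡_

LP₄ : Pred Poly 0ℓ
LP₄ f = ∀ a → IsPermutation (λ x → eval f x a) × IsPermutation (λ y → eval f a y)

LP₄[_] : ℕ → Pred Poly 0ℓ
LP₄[ d ] f = LP₄ f × HasTotalDegree f d

SeparateVariables : Pred Poly 0ℓ
SeparateVariables f = ∃[ h₁ ] ∃[ h₂ ]
    IsPermutation (eval₁ h₁) × IsPermutation (eval₁ h₂)
  × f ≡ (h₁ inX ⊕ h₂ inY)

NormalForm≤2 : Pred Poly 0ℓ
NormalForm≤2 f = ∃[ s₂₀ ] ∃[ s₀₂ ] ∃[ s₁₀ ] ∃[ s₀₁ ] ∃[ s₀₀ ]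
    s₀₁ ^ 3 + s₀₂ ^ 3 ≡ 1#
  × s₁₀ ^ 3 + s₂₀ ^ 3 ≡ 1#
  × f ≡ ( s₂₀ x^ 2F y^ 0F
        ⊕ s₀₂ x^ 0F y^ 2F
        ⊕ s₁₀ x^ 1F y^ 0F
        ⊕ s₀₁ x^ 0F y^ 1F
        ⊕ s₀₀ x^ 0F y^ 0F )

-- The first four monomials are the expansion of
-- (s₂₂xy + s₂₁x + s₁₂y + s₁₂s₂₁s₂₂²)xy.
NormalForm4 : Pred Poly 0ℓ
NormalForm4 f = ∃[ s₂₂ ] ∃[ s₂₁ ] ∃[ s₁₂ ] ∃[ s₂₀ ] ∃[ s₀₂ ] ∃[ s₀₀ ]
    (s₂₂ ^ 3 ≡ 1# × s₂₁ ^ 3 ≡ 1# × s₁₂ ^ 3 ≡ 1#)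
  × s₂₀ * (s₂₀ * s₂₂ + s₂₁ ^ 2) ≡ 0#
  × s₀₂ * (s₀₂ * s₂₂ + s₁₂ ^ 2) ≡ 0#
  × f ≡ ( s₂₂ x^ 2F y^ 2F
        ⊕ s₂₁ x^ 2F y^ 1F
        ⊕ s₁₂ x^ 1F y^ 2F
        ⊕ s₁₂ * s₂₁ * s₂₂ ^ 2 x^ 1F y^ 1F
        ⊕ s₂₀ x^ 2F y^ 0F
        ⊕ s₀₂ x^ 0F y^ 2F
        ⊕ (s₂₀ * s₂₂ + s₂₁ ^ 2) * s₁₂ * s₂₂ x^ 1F y^ 0F
        ⊕ (s₀₂ * s₂₂ + s₁₂ ^ 2) * s₂₁ * s₂₂ x^ 0F y^ 1F
        ⊕ s₀₀ x^ 0F y^ 0F )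

-- P has exactly n elements: a duplicate-free list of length n enumerates it.
HasCardinality : Pred Poly 0ℓ → ℕ → Set
HasCardinality P n = Σ[ fs ∈ List Poly ]
  Unique fs × (_∈ₗ fs) ≐ P × length fs ≡ n

{-# OPTIONS --safe #-}
module Submission where

-- A polynomial h of degree < 4 permutes 𝔽₄ iff its t³-coefficient vanishes and
-- exactly one of its t- and t²-coefficients is nonzero. Applied to all slices f(x,a)
-- and f(a,y), this forces f to have degree ≤ 2 in each variable and makes the local
-- permutation property a condition on the eight coefficients other than s₀₀, which
-- is settled by exhaustion over 𝔽₄. The two normal forms have total degrees ≤ 2
-- and 4, so total degree tells the two families apart; each normal form determines
-- its parameters, so the families are counted by their admissible parameters.

open import Defs
open import Algebra.Bundles using (CommutativeRing)
import Algebra.Properties.CommutativeMonoid.Sum as CommutativeMonoidSum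
import Algebra.Properties.Semiring.Sum as SemiringSum
open import Data.Empty using (⊥-elim)
open import Data.Fin.Base using (toℕ)
open import Data.Fin.Patterns using (0F; 1F; 2F; 3F)
import Data.Fin.Properties as Fin
open import Data.List.Base as List using (List; []; _∷_; length; filter; cartesianProductWith)
open import Data.List.Membership.Propositional using (_∈_)
open import Data.List.Membership.Propositional.Properties
  using (∈-cartesianProductWith⁺; ∈-map∘filter⁺; ∈-map∘filter⁻)
open import Data.List.Properties using (length-map)
open import Data.List.Relation.Unary.All using ([]; _∷_)
open import Data.List.Relation.Unary.AllPairs using ([]; _∷_)
open import Data.List.Relation.Unary.Any using (here; there)
open import Data.List.Relation.Unary.Unique.Propositional using (Unique)
import Data.List.Relation.Unary.Unique.Propositional.Properties as Unique
open import Data.Nat.Base as ℕ using (zero; suc)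
import Data.Nat.Properties as ℕ
open import Data.Product.Base using (_×_; _,_; proj₁; proj₂; ∃-syntax)
open import Data.Sum.Base as Sum using (_⊎_; inj₁; inj₂)
open import Data.Vec.Base using (Vec; []; _∷_; lookup; tabulate; replicate)
import Data.Vec.Properties as Vec
open import Level using (0ℓ)
open import Relation.Binary.Definitions using (DecidableEquality; tri<; tri≈; tri>)
open import Relation.Binary.PropositionalEquality
  using (_≡_; _≢_; _≗_; refl; sym; trans; cong; subst; module ≡-Reasoning)
open import Relation.Nullary.Decidable
  using (Dec; map′; from-yes; ¬?; _×-dec_; _→-dec_; _⊎-dec_)
open import Relation.Nullary.Negation using (contradiction)
open import Relation.Unary using (Pred; Decidable; _≐_; _⊆_; _∪_; _⊥_)
open import Relation.Unary.Properties using (≐-trans)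

open CommutativeRing commutativeRing using (*-assoc; *-comm; +-commutativeMonoid)
open CommutativeMonoidSum +-commutativeMonoid using (∑-comm; sum-cong-≗)
open SemiringSum semiring using (*-distribʳ-sum)

-- Exhaustive checks over coefficient vectors

allVec? : ∀ {n p} {P : Pred (Vec 𝔽₄ n) p} → Decidable P → Dec (∀ v → P v)
allVec? {zero}  P? = map′ (λ { p [] → p }) (λ f → f []) (P? [])
allVec? {suc n} P? = map′ (λ { f (a ∷ v) → f a v }) (λ f a v → f (a ∷ v))
  (all? λ a → allVec? λ v → P? (a ∷ v))

infix 4 _≟ᵥ_ _≟ₚ_

_≟ᵥ_ : ∀ {n} → DecidableEquality (Vec 𝔽₄ n)
_≟ᵥ_ = Vec.≡-dec _≟_

_≟ₚ_ : DecidableEquality Poly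
_≟ₚ_ = Vec.≡-dec _≟ᵥ_

-- Permutation polynomials in one variable

-- As a³ = 1 for every nonzero a, this says that exactly one of a, b is nonzero.
OneNonzero : 𝔽₄ → 𝔽₄ → Set
OneNonzero a b = a ^ 3 + b ^ 3 ≡ 1#

oneNonzero? : ∀ a b → Dec (OneNonzero a b)
oneNonzero? a b = a ^ 3 + b ^ 3 ≟ 1#

PermutationCoefficients : Pred Poly₁ 0ℓ
PermutationCoefficients h =
  lookup h 3F ≡ 0# × OneNonzero (lookup h 1F) (lookup h 2F)

permutationCoefficients? : Decidable PermutationCoefficients
permutationCoefficients? h =
  lookup h 3F ≟ 0# ×-dec oneNonzero? (lookup h 1F) (lookup h 2F)

-- The values of h sum to its t³-coefficient, and those of a permutation sum to 0. The remaining map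
-- c₁t + c₂t² is additive; it is zero if c₁ = c₂ = 0, and has the nonzero root c₁/c₂ if both are
-- nonzero. The code checks all h instead.
permutation⇒coefficients : ∀ h → IsPermutation (eval₁ h) → PermutationCoefficients h
permutation⇒coefficients h (injective , _) =
  from-yes (allVec? λ h →
    (all? λ a → all? λ b → eval₁ h a ≟ eval₁ h b →-dec a ≟ b)
      →-dec permutationCoefficients? h)
    h (λ a b → injective)

-- The solution x of c₂x² + c₁x + c₀ = y when exactly one of c₁, c₂ is nonzero:
-- c₁⁻¹ = c₁², and the square root of c₂⁻¹(y - c₀) is c₂(y - c₀)².
preimage : Poly₁ → 𝔽₄ → 𝔽₄
preimage h y = lookup h 1F ^ 2 * (y - lookup h 0F) + lookup h 2F * (y - lookup h 0F) ^ 2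

-- Such an h is c₁t + c₀ or c₂t² + c₀ with nonzero leading coefficient, and squaring is an
-- automorphism of 𝔽₄.
coefficients⇒permutation : ∀ h → PermutationCoefficients h → IsPermutation (eval₁ h)
coefficients⇒permutation h c =
    (λ {a} {b} → from-yes (allVec? λ h → permutationCoefficients? h →-dec
      (all? λ a → all? λ b → eval₁ h a ≟ eval₁ h b →-dec a ≟ b)) h c a b)
  , (λ y → preimage h y , λ { refl →
      from-yes (allVec? λ h → permutationCoefficients? h →-dec
        (all? λ y → eval₁ h (preimage h y) ≟ y)) h c y })

-- Four roots are too many for a nonzero polynomial of degree < 4.
eval₁≗0⇒≡0 : ∀ h → (∀ a → eval₁ h a ≡ 0#) → h ≡ replicate 4 0#
eval₁≗0⇒≡0 = from-yes (allVec? λ h →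
  (all? λ a → eval₁ h a ≟ 0#) →-dec h ≟ᵥ replicate 4 0#)

isPermutation-resp-≗ : ∀ {φ ψ : 𝔽₄ → 𝔽₄} → φ ≗ ψ → IsPermutation φ → IsPermutation ψ
isPermutation-resp-≗ φ≗ψ (injective , surjective) =
    (λ {a} {b} ψa≡ψb → injective (trans (φ≗ψ a) (trans ψa≡ψb (sym (φ≗ψ b)))))
  , (λ y → let x , φx≡y = surjective y in
      x , λ {z} z≡x → trans (sym (φ≗ψ z)) (φx≡y z≡x))

-- The slices f(x,a) and f(a,y)

-- Slices are kept as coefficient vectors, so that the one-variable criterion applies to them.
_atY_ : Poly → 𝔽₄ → Poly₁
f atY a = tabulate λ i → eval₁ (lookup f i) a

_atX_ : Poly → 𝔽₄ → Poly₁
f atX a = tabulate λ j → eval₁ (tabulate λ i → coeff f i j) a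

eval-atY : ∀ f a b → eval₁ (f atY b) a ≡ eval f a b
eval-atY f a b = sum-cong-≗ λ i → begin
  lookup (f atY b) i * a ^ toℕ i
    ≡⟨ cong (_* a ^ toℕ i) (Vec.lookup∘tabulate (λ i → eval₁ (lookup f i) b) i) ⟩
  eval₁ (lookup f i) b * a ^ toℕ i
    ≡⟨ *-distribʳ-sum (a ^ toℕ i) (λ j → coeff f i j * b ^ toℕ j) ⟩
  sum (λ j → coeff f i j * b ^ toℕ j * a ^ toℕ i)
    ≡⟨ sum-cong-≗ (λ j → swap (coeff f i j) (b ^ toℕ j) (a ^ toℕ i)) ⟩
  sum (λ j → coeff f i j * a ^ toℕ i * b ^ toℕ j) ∎
  where
  open ≡-Reasoning
  swap : ∀ x y z → x * y * z ≡ x * z * y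
  swap x y z = trans (*-assoc x y z) (trans (cong (x *_) (*-comm y z)) (sym (*-assoc x z y)))

eval-atX : ∀ f a b → eval₁ (f atX a) b ≡ eval f a b
eval-atX f a b = begin
  eval₁ (f atX a) b
    ≡⟨ sum-cong-≗ (λ j → cong (_* b ^ toℕ j) (Vec.lookup∘tabulate (λ j → eval₁ (column j) a) j)) ⟩
  sum (λ j → eval₁ (column j) a * b ^ toℕ j)
    ≡⟨ sum-cong-≗ (λ j → *-distribʳ-sum (b ^ toℕ j) (λ i → lookup (column j) i * a ^ toℕ i)) ⟩
  sum (λ j → sum λ i → lookup (column j) i * a ^ toℕ i * b ^ toℕ j)
    ≡⟨ sum-cong-≗ (λ j → sum-cong-≗ λ i →
         cong (λ c → c * a ^ toℕ i * b ^ toℕ j) (Vec.lookup∘tabulate (λ i → coeff f i j) i)) ⟩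
  sum (λ j → sum λ i → coeff f i j * a ^ toℕ i * b ^ toℕ j)
    -- `eval` sums over the powers of x on the outside, so only this slice needs the sums
    -- interchanged.
    ≡⟨ ∑-comm (λ j i → coeff f i j * a ^ toℕ i * b ^ toℕ j) ⟩
  eval f a b ∎
  where
  open ≡-Reasoning
  column = λ j → tabulate λ i → coeff f i j

-- The condition of `LP₄` moved from bijectivity to coefficients, where comparing field elements
-- decides it.
SliceCoefficients : Pred Poly 0ℓ
SliceCoefficients f =
  ∀ a → PermutationCoefficients (f atY a) × PermutationCoefficients (f atX a)

sliceCoefficients? : Decidable SliceCoefficients
sliceCoefficients? f = all? λ a →
  permutationCoefficients? (f atY a) ×-dec permutationCoefficients? (f atX a)

LP₄⇒sliceCoefficients : ∀ f → LP₄ f → SliceCoefficients f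
LP₄⇒sliceCoefficients f lp a =
    permutation⇒coefficients (f atY a)
      (isPermutation-resp-≗ (λ x → sym (eval-atY f x a)) (proj₁ (lp a)))
  , permutation⇒coefficients (f atX a)
      (isPermutation-resp-≗ (λ y → sym (eval-atX f a y)) (proj₂ (lp a)))

sliceCoefficients⇒LP₄ : ∀ f → SliceCoefficients f → LP₄ f
sliceCoefficients⇒LP₄ f c a =
    isPermutation-resp-≗ (λ x → eval-atY f x a)
      (coefficients⇒permutation (f atY a) (proj₁ (c a)))
  , isPermutation-resp-≗ (λ y → eval-atX f a y)
      (coefficients⇒permutation (f atX a) (proj₂ (c a)))

-- The two normal forms

-- Packing the parameters into one vector lets both families share the exhaustive checks and the
-- counting.
Image : ∀ {n} → (Vec 𝔽₄ n → Poly) → Pred (Vec 𝔽₄ n) 0ℓ → Pred Poly 0ℓ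
Image form P f = ∃[ s ] P s × f ≡ form s

form≤2 : Vec 𝔽₄ 5 → Poly
form≤2 (s₂₀ ∷ s₀₂ ∷ s₁₀ ∷ s₀₁ ∷ s₀₀ ∷ []) =
    s₂₀ x^ 2F y^ 0F
  ⊕ s₀₂ x^ 0F y^ 2F
  ⊕ s₁₀ x^ 1F y^ 0F
  ⊕ s₀₁ x^ 0F y^ 1F
  ⊕ s₀₀ x^ 0F y^ 0F

Admissible≤2 : Pred (Vec 𝔽₄ 5) 0ℓ
Admissible≤2 (s₂₀ ∷ s₀₂ ∷ s₁₀ ∷ s₀₁ ∷ s₀₀ ∷ []) = OneNonzero s₀₁ s₀₂ × OneNonzero s₁₀ s₂₀

admissible≤2? : Decidable Admissible≤2
admissible≤2? (s₂₀ ∷ s₀₂ ∷ s₁₀ ∷ s₀₁ ∷ s₀₀ ∷ []) =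
  oneNonzero? s₀₁ s₀₂ ×-dec oneNonzero? s₁₀ s₂₀

normalForm≤2≐image : NormalForm≤2 ≐ Image form≤2 Admissible≤2
normalForm≤2≐image =
    (λ (s₂₀ , s₀₂ , s₁₀ , s₀₁ , s₀₀ , p , q , f≡) →
      s₂₀ ∷ s₀₂ ∷ s₁₀ ∷ s₀₁ ∷ s₀₀ ∷ [] , (p , q) , f≡)
  , (λ { (s₂₀ ∷ s₀₂ ∷ s₁₀ ∷ s₀₁ ∷ s₀₀ ∷ [] , (p , q) , f≡) →
      s₂₀ , s₀₂ , s₁₀ , s₀₁ , s₀₀ , p , q , f≡ })

coefficients≤2 : Poly → Vec 𝔽₄ 5
coefficients≤2 f =
  coeff f 2F 0F ∷ coeff f 0F 2F ∷ coeff f 1F 0F ∷ coeff f 0F 1F ∷ coeff f 0F 0F ∷ []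

coefficients≤2-form≤2 : ∀ s → coefficients≤2 (form≤2 s) ≡ s
coefficients≤2-form≤2 = from-yes (allVec? λ s → coefficients≤2 (form≤2 s) ≟ᵥ s)

form4 : Vec 𝔽₄ 6 → Poly
form4 (s₂₂ ∷ s₂₁ ∷ s₁₂ ∷ s₂₀ ∷ s₀₂ ∷ s₀₀ ∷ []) =
    s₂₂ x^ 2F y^ 2F
  ⊕ s₂₁ x^ 2F y^ 1F
  ⊕ s₁₂ x^ 1F y^ 2F
  ⊕ s₁₂ * s₂₁ * s₂₂ ^ 2 x^ 1F y^ 1F
  ⊕ s₂₀ x^ 2F y^ 0F
  ⊕ s₀₂ x^ 0F y^ 2F
  ⊕ (s₂₀ * s₂₂ + s₂₁ ^ 2) * s₁₂ * s₂₂ x^ 1F y^ 0F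
  ⊕ (s₀₂ * s₂₂ + s₁₂ ^ 2) * s₂₁ * s₂₂ x^ 0F y^ 1F
  ⊕ s₀₀ x^ 0F y^ 0F

Admissible4 : Pred (Vec 𝔽₄ 6) 0ℓ
Admissible4 (s₂₂ ∷ s₂₁ ∷ s₁₂ ∷ s₂₀ ∷ s₀₂ ∷ s₀₀ ∷ []) =
    (s₂₂ ^ 3 ≡ 1# × s₂₁ ^ 3 ≡ 1# × s₁₂ ^ 3 ≡ 1#)
  × s₂₀ * (s₂₀ * s₂₂ + s₂₁ ^ 2) ≡ 0#
  × s₀₂ * (s₀₂ * s₂₂ + s₁₂ ^ 2) ≡ 0#

admissible4? : Decidable Admissible4
admissible4? (s₂₂ ∷ s₂₁ ∷ s₁₂ ∷ s₂₀ ∷ s₀₂ ∷ s₀₀ ∷ []) =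
        (s₂₂ ^ 3 ≟ 1# ×-dec s₂₁ ^ 3 ≟ 1# ×-dec s₁₂ ^ 3 ≟ 1#)
  ×-dec s₂₀ * (s₂₀ * s₂₂ + s₂₁ ^ 2) ≟ 0#
  ×-dec s₀₂ * (s₀₂ * s₂₂ + s₁₂ ^ 2) ≟ 0#

normalForm4≐image : NormalForm4 ≐ Image form4 Admissible4
normalForm4≐image =
    (λ (s₂₂ , s₂₁ , s₁₂ , s₂₀ , s₀₂ , s₀₀ , p , q , r , f≡) →
      s₂₂ ∷ s₂₁ ∷ s₁₂ ∷ s₂₀ ∷ s₀₂ ∷ s₀₀ ∷ [] , (p , q , r) , f≡)
  , (λ { (s₂₂ ∷ s₂₁ ∷ s₁₂ ∷ s₂₀ ∷ s₀₂ ∷ s₀₀ ∷ [] , (p , q , r) , f≡) →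
      s₂₂ , s₂₁ , s₁₂ , s₂₀ , s₀₂ , s₀₀ , p , q , r , f≡ })

-- The coefficients of xy, x and y are left out, being functions of these six.
coefficients4 : Poly → Vec 𝔽₄ 6
coefficients4 f =
  coeff f 2F 2F ∷ coeff f 2F 1F ∷ coeff f 1F 2F ∷
  coeff f 2F 0F ∷ coeff f 0F 2F ∷ coeff f 0F 0F ∷ []

coefficients4-form4 : ∀ s → coefficients4 (form4 s) ≡ s
coefficients4-form4 = from-yes (allVec? λ s → coefficients4 (form4 s) ≟ᵥ s)

-- Classification

quadratic : 𝔽₄ → 𝔽₄ → 𝔽₄ → Poly₁
quadratic c₀ c₁ c₂ = c₀ ∷ c₁ ∷ c₂ ∷ 0# ∷ []

biquadratic : Poly₁ → Poly₁ → Poly₁ → Poly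
biquadratic r₀ r₁ r₂ = r₀ ∷ r₁ ∷ r₂ ∷ replicate 4 0# ∷ []

-- The parameters are read off f instead of being quantified existentially, so deciding this takes
-- no search.
CanonicalForm : Pred Poly 0ℓ
CanonicalForm f =
    (Admissible≤2 (coefficients≤2 f) × f ≡ form≤2 (coefficients≤2 f))
  ⊎ (Admissible4 (coefficients4 f) × f ≡ form4 (coefficients4 f))

canonicalForm? : Decidable CanonicalForm
canonicalForm? f =
    (admissible≤2? (coefficients≤2 f) ×-dec f ≟ₚ form≤2 (coefficients≤2 f))
  ⊎-dec (admissible4? (coefficients4 f) ×-dec f ≟ₚ form4 (coefficients4 f))

-- The quantifiers are ordered so that the condition on the slices f(x,a), which
-- does not involve s₀₁, s₀₂ and s₀₀, prunes the search early.
biquadratic-canonicalForm :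
  ∀ s₁₁ s₁₂ s₂₁ s₂₂ s₁₀ s₂₀ →
  (∀ a → OneNonzero (eval₁ (quadratic s₁₀ s₁₁ s₁₂) a) (eval₁ (quadratic s₂₀ s₂₁ s₂₂) a)) →
  ∀ s₀₁ s₀₂ →
  (∀ a → OneNonzero (eval₁ (quadratic s₀₁ s₁₁ s₂₁) a) (eval₁ (quadratic s₀₂ s₁₂ s₂₂) a)) →
  ∀ s₀₀ → CanonicalForm
    (biquadratic (quadratic s₀₀ s₀₁ s₀₂) (quadratic s₁₀ s₁₁ s₁₂) (quadratic s₂₀ s₂₁ s₂₂))
biquadratic-canonicalForm = from-yes (
  all? λ s₁₁ → all? λ s₁₂ → all? λ s₂₁ → all? λ s₂₂ → all? λ s₁₀ → all? λ s₂₀ →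
  (all? λ a → oneNonzero? (eval₁ (quadratic s₁₀ s₁₁ s₁₂) a) (eval₁ (quadratic s₂₀ s₂₁ s₂₂) a))
  →-dec (all? λ s₀₁ → all? λ s₀₂ →
  (all? λ a → oneNonzero? (eval₁ (quadratic s₀₁ s₁₁ s₂₁) a) (eval₁ (quadratic s₀₂ s₁₂ s₂₂) a))
  →-dec (all? λ s₀₀ → canonicalForm?
    (biquadratic (quadratic s₀₀ s₀₁ s₀₂) (quadratic s₁₀ s₁₁ s₁₂) (quadratic s₂₀ s₂₁ s₂₂)))))

-- The x³-coefficient of f(x,a) vanishes for all a, hence vanishes as a polynomial
-- in a; likewise for the y³-coefficient.
sliceCoefficients⇒canonicalForm : ∀ f → SliceCoefficients f → CanonicalForm f
sliceCoefficients⇒canonicalForm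
  ((s₀₀ ∷ s₀₁ ∷ s₀₂ ∷ s₀₃ ∷ []) ∷ (s₁₀ ∷ s₁₁ ∷ s₁₂ ∷ s₁₃ ∷ []) ∷
   (s₂₀ ∷ s₂₁ ∷ s₂₂ ∷ s₂₃ ∷ []) ∷ (s₃₀ ∷ s₃₁ ∷ s₃₂ ∷ s₃₃ ∷ []) ∷ []) c =
  restrict
    (eval₁≗0⇒≡0 (s₃₀ ∷ s₃₁ ∷ s₃₂ ∷ s₃₃ ∷ []) (λ a → proj₁ (proj₁ (c a))))
    (eval₁≗0⇒≡0 (s₀₃ ∷ s₁₃ ∷ s₂₃ ∷ s₃₃ ∷ []) (λ a → proj₁ (proj₂ (c a))))
    (λ a → proj₂ (proj₁ (c a)))
    (λ a → proj₂ (proj₂ (c a)))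
  where
  restrict :
    s₃₀ ∷ s₃₁ ∷ s₃₂ ∷ s₃₃ ∷ [] ≡ replicate 4 0# →
    s₀₃ ∷ s₁₃ ∷ s₂₃ ∷ s₃₃ ∷ [] ≡ replicate 4 0# →
    (∀ a → OneNonzero (eval₁ (s₁₀ ∷ s₁₁ ∷ s₁₂ ∷ s₁₃ ∷ []) a)
                      (eval₁ (s₂₀ ∷ s₂₁ ∷ s₂₂ ∷ s₂₃ ∷ []) a)) →
    (∀ a → OneNonzero (eval₁ (s₀₁ ∷ s₁₁ ∷ s₂₁ ∷ s₃₁ ∷ []) a)
                      (eval₁ (s₀₂ ∷ s₁₂ ∷ s₂₂ ∷ s₃₂ ∷ []) a)) →
    CanonicalForm
      ( (s₀₀ ∷ s₀₁ ∷ s₀₂ ∷ s₀₃ ∷ []) ∷ (s₁₀ ∷ s₁₁ ∷ s₁₂ ∷ s₁₃ ∷ [])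
      ∷ (s₂₀ ∷ s₂₁ ∷ s₂₂ ∷ s₂₃ ∷ []) ∷ (s₃₀ ∷ s₃₁ ∷ s₃₂ ∷ s₃₃ ∷ []) ∷ [])
  -- Both matches set `s₃₃` to 0; what remains is the biquadratic shape.
  restrict refl refl p q =
    biquadratic-canonicalForm s₁₁ s₁₂ s₂₁ s₂₂ s₁₀ s₂₀ p s₀₁ s₀₂ q s₀₀

LP₄⇒normalForm : ∀ f → LP₄ f → NormalForm≤2 f ⊎ NormalForm4 f
LP₄⇒normalForm f lp = Sum.map
  (λ c → proj₂ normalForm≤2≐image {f} (coefficients≤2 f , c))
  (λ c → proj₂ normalForm4≐image {f} (coefficients4 f , c))
  (sliceCoefficients⇒canonicalForm f (LP₄⇒sliceCoefficients f lp))

-- Total degrees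

hasTotalDegree? : ∀ f d → Dec (HasTotalDegree f d)
hasTotalDegree? f d =
        (Fin.any? λ i → Fin.any? λ j →
          toℕ i ℕ.+ toℕ j ℕ.≟ d ×-dec ¬? (coeff f i j ≟ 0#))
  ×-dec (Fin.all? λ i → Fin.all? λ j →
          d ℕ.<? toℕ i ℕ.+ toℕ j →-dec coeff f i j ≟ 0#)

-- Were the degrees different, the nonzero coefficient witnessing the larger would vanish by the
-- bound for the smaller.
totalDegree-unique : ∀ f {d e} → HasTotalDegree f d → HasTotalDegree f e → d ≡ e
totalDegree-unique f {d} {e} ((i , j , refl , cᵢⱼ≢0) , <⇒0) ((k , l , refl , cₖₗ≢0) , <⇒0′)
  with ℕ.<-cmp d e
... | tri< d<e _ _ = contradiction (<⇒0 k l d<e) cₖₗ≢0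
... | tri≈ _ d≡e _ = d≡e
... | tri> _ _ e<d = contradiction (<⇒0′ i j e<d) cᵢⱼ≢0

LP₄-disjoint : ∀ {d e} → d ≢ e → LP₄[ d ] ⊥ LP₄[ e ]
LP₄-disjoint d≢e {f} ((_ , p) , (_ , q)) = d≢e (totalDegree-unique f p q)

≤2⇒LP₄ : ∀ f → (LP₄[ 1 ] ∪ LP₄[ 2 ]) f → LP₄ f
≤2⇒LP₄ f (inj₁ (lp , _)) = lp
≤2⇒LP₄ f (inj₂ (lp , _)) = lp

≤2-4-disjoint : (LP₄[ 1 ] ∪ LP₄[ 2 ]) ⊥ LP₄[ 4 ]
≤2-4-disjoint {f} (inj₁ p , q) = LP₄-disjoint (λ ()) {f} (p , q)
≤2-4-disjoint {f} (inj₂ p , q) = LP₄-disjoint (λ ()) {f} (p , q)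

form≤2-LP₄ : ∀ s → Admissible≤2 s → (LP₄[ 1 ] ∪ LP₄[ 2 ]) (form≤2 s)
-- Admissibility excludes constants; the degree is 1 exactly when `s₂₀` and `s₀₂` both vanish.
form≤2-LP₄ s admissible = Sum.map (lp ,_) (lp ,_)
  (from-yes (allVec? λ s → admissible≤2? s →-dec
    (hasTotalDegree? (form≤2 s) 1 ⊎-dec hasTotalDegree? (form≤2 s) 2)) s admissible)
  where
  lp : LP₄ (form≤2 s)
  lp = sliceCoefficients⇒LP₄ (form≤2 s) (from-yes (allVec? λ s →
    admissible≤2? s →-dec sliceCoefficients? (form≤2 s)) s admissible)

form4-LP₄ : ∀ s → Admissible4 s → LP₄[ 4 ] (form4 s)
form4-LP₄ s admissible =
    sliceCoefficients⇒LP₄ (form4 s) (from-yes (allVec? λ s →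
      admissible4? s →-dec sliceCoefficients? (form4 s)) s admissible)
  -- The x²y² term survives because s₂₂³ = 1 makes `s₂₂` nonzero.
  , from-yes (allVec? λ s →
      admissible4? s →-dec hasTotalDegree? (form4 s) 4) s admissible

-- The two families and their normal forms

normalForm≤2⇒LP₄ : ∀ f → NormalForm≤2 f → (LP₄[ 1 ] ∪ LP₄[ 2 ]) f
normalForm≤2⇒LP₄ f nf =
  let s , admissible , f≡ = proj₁ normalForm≤2≐image {f} nf in
  subst (LP₄[ 1 ] ∪ LP₄[ 2 ]) (sym f≡) (form≤2-LP₄ s admissible)

normalForm4⇒LP₄ : ∀ f → NormalForm4 f → LP₄[ 4 ] f
normalForm4⇒LP₄ f nf =
  let s , admissible , f≡ = proj₁ normalForm4≐image {f} nf in
  subst LP₄[ 4 ] (sym f≡) (form4-LP₄ s admissible)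

-- A local permutation polynomial has one of the two normal forms, and the other one would force
-- total degree 4.
LP₄≐normalForm≤2 : LP₄[ 1 ] ∪ LP₄[ 2 ] ≐ NormalForm≤2
LP₄≐normalForm≤2 = (λ {f} → to f) , (λ {f} → normalForm≤2⇒LP₄ f)
  where
  select : ∀ f → (LP₄[ 1 ] ∪ LP₄[ 2 ]) f → NormalForm≤2 f ⊎ NormalForm4 f → NormalForm≤2 f
  select f p (inj₁ nf) = nf
  select f p (inj₂ nf) = ⊥-elim (≤2-4-disjoint {f} (p , normalForm4⇒LP₄ f nf))

  to : ∀ f → (LP₄[ 1 ] ∪ LP₄[ 2 ]) f → NormalForm≤2 f
  to f p = select f p (LP₄⇒normalForm f (≤2⇒LP₄ f p))

LP₄≐normalForm4 : LP₄[ 4 ] ≐ NormalForm4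
LP₄≐normalForm4 = (λ {f} → to f) , (λ {f} → normalForm4⇒LP₄ f)
  where
  select : ∀ f → LP₄[ 4 ] f → NormalForm≤2 f ⊎ NormalForm4 f → NormalForm4 f
  select f p (inj₁ nf) = ⊥-elim (≤2-4-disjoint {f} (normalForm≤2⇒LP₄ f nf , p))
  select f p (inj₂ nf) = nf

  to : ∀ f → LP₄[ 4 ] f → NormalForm4 f
  to f p = select f p (LP₄⇒normalForm f (proj₁ p))

form≤2-separateVariables : ∀ s → Admissible≤2 s → SeparateVariables (form≤2 s)
form≤2-separateVariables (s₂₀ ∷ s₀₂ ∷ s₁₀ ∷ s₀₁ ∷ s₀₀ ∷ []) (p , q) =
    -- The constant term can be split freely; all of it goes to the summand in x.
    quadratic s₀₀ s₁₀ s₂₀ , quadratic 0# s₀₁ s₀₂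
  , coefficients⇒permutation (quadratic s₀₀ s₁₀ s₂₀) (refl , q)
  , coefficients⇒permutation (quadratic 0# s₀₁ s₀₂) (refl , p)
  , from-yes (all? λ s₂₀ → all? λ s₀₂ → all? λ s₁₀ → all? λ s₀₁ → all? λ s₀₀ →
      form≤2 (s₂₀ ∷ s₀₂ ∷ s₁₀ ∷ s₀₁ ∷ s₀₀ ∷ [])
        ≟ₚ (quadratic s₀₀ s₁₀ s₂₀ inX ⊕ quadratic 0# s₀₁ s₀₂ inY)) s₂₀ s₀₂ s₁₀ s₀₁ s₀₀

normalForm≤2⇒separateVariables : ∀ f → NormalForm≤2 f → SeparateVariables f
normalForm≤2⇒separateVariables f nf =
  let s , admissible , f≡ = proj₁ normalForm≤2≐image {f} nf in
  subst SeparateVariables (sym f≡) (form≤2-separateVariables s admissible)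

-- Counting

elements : List 𝔽₄
elements = 0# ∷ 1# ∷ ω ∷ ω² ∷ []

elements-unique : Unique elements
elements-unique =
  ((λ ()) ∷ (λ ()) ∷ (λ ()) ∷ []) ∷ ((λ ()) ∷ (λ ()) ∷ []) ∷ ((λ ()) ∷ []) ∷ [] ∷ []

∈-elements : ∀ a → a ∈ elements
∈-elements 0# = here refl
∈-elements 1# = there (here refl)
∈-elements ω  = there (there (here refl))
∈-elements ω² = there (there (there (here refl)))

vectors : ∀ n → List (Vec 𝔽₄ n)
vectors zero    = [] ∷ []
vectors (suc n) = cartesianProductWith _∷_ elements (vectors n)

vectors-unique : ∀ n → Unique (vectors n)
vectors-unique zero    = [] ∷ []
vectors-unique (suc n) =
  Unique.cartesianProductWith⁺ _∷_ Vec.∷-injective elements-unique (vectors-unique n)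

∈-vectors : ∀ {n} (v : Vec 𝔽₄ n) → v ∈ vectors n
∈-vectors []      = here refl
∈-vectors (a ∷ v) = ∈-cartesianProductWith⁺ _∷_ (∈-elements a) (∈-vectors v)

-- The left inverse makes `form` injective, so mapping it over the admissible vectors creates no
-- duplicates.
image-cardinality : ∀ {n} (form : Vec 𝔽₄ n → Poly) (coefficients : Poly → Vec 𝔽₄ n) →
  (∀ s → coefficients (form s) ≡ s) →
  {P : Pred (Vec 𝔽₄ n) 0ℓ} (P? : Decidable P) {Q : Pred Poly 0ℓ} →
  Q ≐ Image form P → HasCardinality Q (length (filter P? (vectors n)))
image-cardinality {n} form coefficients left-inverse {P} P? {Q} (Q⊆ , ⊆Q) =
    List.map form (filter P? (vectors n))
  , Unique.map⁺ form-injective (Unique.filter⁺ P? (vectors-unique n))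
  , ( (λ f∈ → let s , _ , f≡ , p = ∈-map∘filter⁻ form P? {xs = vectors n} f∈ in ⊆Q (s , p , f≡))
    , (λ q → let s , p , f≡ = Q⊆ q in ∈-map∘filter⁺ form P? (s , ∈-vectors s , f≡ , p)) )
  , length-map form (filter P? (vectors n))
  where
  form-injective : ∀ {s t} → form s ≡ form t → s ≡ t
  form-injective {s} {t} eq =
    trans (sym (left-inverse s)) (trans (cong coefficients eq) (left-inverse t))

theorem3p1 : (LP₄ ≐ (LP₄[ 1 ] ∪ LP₄[ 2 ]) ∪ LP₄[ 4 ])
    × ((LP₄[ 1 ] ∪ LP₄[ 2 ]) ⊥ LP₄[ 4 ])
    × ( (LP₄[ 1 ] ⊥ LP₄[ 2 ])
    × (LP₄[ 1 ] ∪ LP₄[ 2 ] ⊆ SeparateVariables)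
    × (LP₄[ 1 ] ∪ LP₄[ 2 ] ≐ NormalForm≤2)
    × HasCardinality (LP₄[ 1 ] ∪ LP₄[ 2 ]) 144
    )
    × ( (LP₄[ 4 ] ≐ NormalForm4)
    × HasCardinality LP₄[ 4 ] 432
    )
theorem3p1 =
    ( (λ {f} lp → Sum.map (normalForm≤2⇒LP₄ f) (normalForm4⇒LP₄ f) (LP₄⇒normalForm f lp))
    , (λ {f} → λ { (inj₁ p) → ≤2⇒LP₄ f p ; (inj₂ (lp , _)) → lp }) )
  , (λ {f} → ≤2-4-disjoint {f})
  , ( (λ {f} → LP₄-disjoint (λ ()) {f})
    , (λ {f} p → normalForm≤2⇒separateVariables f (proj₁ LP₄≐normalForm≤2 {f} p))
    , LP₄≐normalForm≤2
    -- The length evaluates to 144 = 6 · 6 · 4: six admissible pairs for each variable and four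
    -- constants.
    , image-cardinality form≤2 coefficients≤2 coefficients≤2-form≤2 admissible≤2?
        (≐-trans LP₄≐normalForm≤2 normalForm≤2≐image) )
  , ( LP₄≐normalForm4
    -- Here 432 = 3³ · 2 · 2 · 4: `s₂₀` is 0 or s₂₁²/s₂₂, `s₀₂` is 0 or s₁₂²/s₂₂, and `s₀₀` is free.
    , image-cardinality form4 coefficients4 coefficients4-form4 admissible4?
        (≐-trans LP₄≐normalForm4 normalForm4≐image) )
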